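{- The number of minimal absent words of an unrooted tree with $n$ nodes whose edges are labeled by letters from an alphabet of size $\sigma$ is $O(n^{2}\sigma)$. That is, there is an absolute constant $C>0$ such that for all integers $n,\sigma\ge 1$ and every unrooted tree $T$ with $n$ nodes and edges labeled by letters of an alphabet of size $\sigma$, $|\mathrm{MAW}(T)|\le C\,n^{2}\sigma$.
   Context: Let $T$ be an unrooted tree (a finite connected acyclic undirected graph) whose edges are labeled by letters of a finite alphabet $\Sigma$. The language $L(T)$ is the set of all words obtained by concatenating the edge labels along a simple path of $T$, read from one endpoint to the other (starting from any node, in either direction; the empty path gives the empty word). This language is closed under taking factors (contiguous subwords). A word $aub$ with $a,b\in\Sigma$ and $u$ a (possibly empty) word over $\Sigma$ is a minimal absent word of $T$ if $aub\notin L(T)$ while $au\in L(T)$ and $ub\in L(T)$. The set of minimal absent words of $T$ is $\mathrm{MAW}(T)$. -}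

module Defs where

open import Data.Fin.Base using (Fin)
open import Data.List.Base using (List; []; _∷_; _∷ʳ_; length)
open import Data.List.Membership.Propositional using (_∈_)
open import Data.List.Relation.Unary.Unique.Propositional using (Unique)
open import Data.Maybe.Base using (Maybe; just; nothing)
open import Data.Nat.Base using (ℕ; _≤_)
open import Data.Product.Base using (∃-syntax; _×_)
open import Function.Bundles using (_⇔_)
open import Level using (Level; _⊔_)
open import Relation.Binary.PropositionalEquality.Core using (_≡_)
open import Relation.Nullary.Negation.Core using (¬_)
open import Relation.Unary using (Pred)

Word : ℕ → Set
Word σ = List (Fin σ)

-- A finite simple undirected graph on the nodes Fin n with edges labelled by
-- Fin σ: label u v is just a when uv is an edge labelled a, and nothing when
-- u and v are not adjacent.
record LabelledGraph (n σ : ℕ) : Set where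
  field
    label     : Fin n → Fin n → Maybe (Fin σ)
    label-sym : ∀ u v → label u v ≡ label v u
    loopless  : ∀ u → label u u ≡ nothing

module _ {n σ : ℕ} (G : LabelledGraph n σ) where
  open LabelledGraph G

  Adjacent : Fin n → Fin n → Set
  Adjacent u v = ∃[ a ] label u v ≡ just a

  -- Walk u v w: a walk from u to v whose edge labels spell w.
  data Walk : Fin n → Fin n → Word σ → Set where
    stop : ∀ u → Walk u u []
    step : ∀ u {v x a w} → label u v ≡ just a → Walk v x w → Walk u x (a ∷ w)

  nodes : ∀ {u v w} → Walk u v w → List (Fin n)
  nodes (stop u)     = u ∷ []
  nodes (step u _ p) = u ∷ nodes p

  Simple : ∀ {u v w} → Walk u v w → Set
  Simple p = Unique (nodes p)

  Connected : Set
  Connected = ∀ u v → ∃[ w ] Walk u v w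

  -- A cycle is a simple path on at least three nodes together with an edge
  -- joining its last node to its first.
  IsCycle : ∀ {u v w} → Walk u v w → Set
  IsCycle {u} {v} p = Simple p × 3 ≤ length (nodes p) × Adjacent v u

  Acyclic : Set
  Acyclic = ∀ {u v w} (p : Walk u v w) → ¬ IsCycle p

record Tree (n σ : ℕ) : Set where
  field
    graph     : LabelledGraph n σ
    connected : Connected graph
    acyclic   : Acyclic graph

module _ {n σ : ℕ} (T : Tree n σ) where
  open Tree T

  L : Word σ → Set
  L w = ∃[ u ] ∃[ v ] ∃[ p ] Simple graph {u} {v} {w} p

  MAW : Word σ → Set
  MAW w = ∃[ a ] ∃[ u ] ∃[ b ]
    (w ≡ a ∷ (u ∷ʳ b) × ¬ L (a ∷ (u ∷ʳ b)) × L (a ∷ u) × L (u ∷ʳ b))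

-- The subset P of A is finite with exactly k elements: it is listed, without
-- repetition, by a list of length k.
HasCardinality : ∀ {a p : Level} {A : Set a} → Pred A p → ℕ → Set (a ⊔ p)
HasCardinality P k =
  ∃[ xs ] (Unique xs × (∀ x → x ∈ xs ⇔ P x) × length xs ≡ k)

{-# OPTIONS --safe #-}
-- Two distinct simple paths with the same endpoints would, after their last
-- common initial node, close up to a cycle; so in a tree the endpoints of a
-- simple path determine its word, and at most n² words occur.  A minimal absent
-- word is one of these words followed by a letter, which leaves n²σ candidates.
module Submission where

open import Data.Empty using (⊥-elim)
open import Data.Fin.Base using (Fin)
open import Data.Fin.Properties using (_≟_)
open import Data.List.Base
  using (List; []; _∷_; _∷ʳ_; length; map; allFin; filter; deduplicate;
         cartesianProductWith; initLast; _∷ʳ′_)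
open import Data.List.Membership.Propositional using (_∈_)
open import Data.List.Membership.Propositional.Properties
  using (∈-allFin; ∈-filter⁺; ∈-filter⁻; ∈-deduplicate⁺;
         ∈-cartesianProductWith⁺; ∈-cartesianProductWith⁻)
open import Data.List.Properties
  using (≡-dec; ∷-injective; ∷ʳ-injective; length-++; length-map; length-tabulate; length-filter;
         length-deduplicate)
open import Data.List.Relation.Unary.All as All using (All; []; _∷_)
open import Data.List.Relation.Unary.All.Properties using (¬Any⇒All¬)
open import Data.List.Relation.Unary.AllPairs using ([]; _∷_)
open import Data.List.Relation.Unary.Any using (here; there; any?)
open import Data.List.Relation.Unary.Unique.DecPropositional.Properties using (deduplicate-!)
open import Data.List.Relation.Unary.Unique.Propositional.Properties using (filter⁺)
open import Data.Maybe.Base using (just)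
open import Data.Maybe.Properties using (just-injective)
open import Data.Nat.Base using (ℕ; _≤_; _<_; _+_; _*_; _^_; z≤n; s≤s)
open import Data.Nat.Properties
  using (≤-trans; ≤-reflexive; +-identityʳ; *-identityʳ)
open import Data.Product.Base using (∃-syntax; _×_; _,_; proj₁; proj₂)
open import Data.Unit.Base using (⊤; tt)
open import Function.Base using (id)
open import Function.Bundles using (mk⇔)
open import Relation.Binary.Definitions using (DecidableEquality)
open import Relation.Binary.PropositionalEquality
  using (_≡_; _≢_; refl; sym; trans; cong; cong₂; subst; module ≡-Reasoning)
open import Relation.Nullary using (¬_; yes; no; ¬?; _×-dec_)
open import Relation.Nullary.Decidable using (map′)
open import Relation.Unary using (Pred; Decidable)
open import Defs

module _ {a p} {A : Set a} (_≟ᴬ_ : DecidableEquality A) {P : Pred A p} where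

  -- `HasCardinality` asks for an exact list without repetitions. A list that merely covers `P` is
  -- turned into one by removing duplicates and then non-members; neither operation lengthens it.
  enumerated⇒finite : Decidable P → (xs : List A) → (∀ {x} → P x → x ∈ xs) →
                      ∃[ k ] (HasCardinality P k × k ≤ length xs)
  enumerated⇒finite P? xs complete =
    length ys ,
    (ys , filter⁺ P? (deduplicate-! _≟ᴬ_ xs) ,
     (λ x → mk⇔ (λ x∈ys → proj₂ (∈-filter⁻ P? {xs = deduplicate _≟ᴬ_ xs} x∈ys))
                (λ Px → ∈-filter⁺ P? (∈-deduplicate⁺ _≟ᴬ_ (complete Px)) Px)) ,
     refl) ,
    ≤-trans (length-filter P? (deduplicate _≟ᴬ_ xs)) (length-deduplicate _≟ᴬ_ xs)
    where ys = filter P? (deduplicate _≟ᴬ_ xs)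

length-cartesianProductWith :
  ∀ {a b c} {A : Set a} {B : Set b} {C : Set c} (f : A → B → C) xs ys →
  length (cartesianProductWith f xs ys) ≡ length xs * length ys
length-cartesianProductWith f []       ys = refl
length-cartesianProductWith f (x ∷ xs) ys =
  trans (length-++ (map (f x) ys))
        (cong₂ _+_ (length-map (f x) ys) (length-cartesianProductWith f xs ys))

module _ {n σ : ℕ} (G : LabelledGraph n σ) where
  open LabelledGraph G

  -- The predicate on nodes lets loop erasure and reversal preserve avoidance of a given node, as
  -- the cycle argument requires.
  WalkIn SimpleWalkIn : ∀ {p} → Pred (Fin n) p → Fin n → Fin n → Set p
  WalkIn       P u v = ∃[ w ] ∃[ p ] All P (nodes G {u} {v} {w} p)
  SimpleWalkIn P u v = ∃[ w ] ∃[ p ] (Simple G {u} {v} {w} p × All P (nodes G p))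

  start∈nodes : ∀ {u v w} (p : Walk G u v w) → u ∈ nodes G p
  start∈nodes (stop _)     = here refl
  start∈nodes (step _ _ _) = here refl

  end∈nodes : ∀ {u v w} (p : Walk G u v w) → v ∈ nodes G p
  end∈nodes (stop _)     = here refl
  end∈nodes (step _ _ p) = there (end∈nodes p)

  dropUntil : ∀ {q} {P : Pred (Fin n) q} {t u v w} (p : Walk G u v w) →
              t ∈ nodes G p → Simple G p → All P (nodes G p) → SimpleWalkIn P t v
  dropUntil p@(stop _)     (here refl) s       a       = _ , p , s , a
  dropUntil p@(step _ _ _) (here refl) s       a       = _ , p , s , a
  dropUntil (step _ _ p)   (there t∈p) (_ ∷ s) (_ ∷ a) = dropUntil p t∈p s a

  -- The tail is made simple first. If it returns to the starting node, its suffix from there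
  -- already suffices; otherwise the first edge can be put back.
  loopErase : ∀ {q} {P : Pred (Fin n) q} {u v} → WalkIn P u v → SimpleWalkIn P u v
  loopErase (_ , stop u , a) = _ , stop u , [] ∷ [] , a
  loopErase (_ , step u e p , Pu ∷ a) with loopErase (_ , p , a)
  ... | _ , p′ , s , a′ with any? (u ≟_) (nodes G p′)
  ...   | yes u∈p′ = dropUntil p′ u∈p′ s a′
  ...   | no  u∉p′ = _ , step u e p′ , ¬Any⇒All¬ _ u∉p′ ∷ s , Pu ∷ a′

  -- The second walk acts as an accumulator: each edge of the first is reversed and put in front of
  -- it. Reversal and concatenation thus come from a single recursion.
  walkIn-euclidean : ∀ {q} {P : Pred (Fin n) q} {u v x} →
                     WalkIn P u x → WalkIn P u v → WalkIn P x v
  walkIn-euclidean (_ , stop _ , _) r = r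
  walkIn-euclidean (_ , step u {v = v} e p , _ ∷ a) (_ , r , b) =
    walkIn-euclidean (_ , p , a)
      (_ , step v (trans (label-sym v u) e) r , All.lookup a (start∈nodes p) ∷ b)

  walkIn-sym : ∀ {q} {P : Pred (Fin n) q} {u v} → WalkIn P u v → WalkIn P v u
  walkIn-sym (_ , p , a) =
    walkIn-euclidean (_ , p , a) (_ , stop _ , All.lookup a (start∈nodes p) ∷ [])

  module _ (acyclic : Acyclic G) where

    -- If `x` and `y` differed, the path between them that avoids `u` would form a cycle with the
    -- two edges at `u`.
    uniqueNeighbour : ∀ {u x y a b} → label u x ≡ just a → label u y ≡ just b →
                      SimpleWalkIn (u ≢_) x y → x ≡ y
    uniqueNeighbour e e′ (_ , stop _ , _) = refl
    uniqueNeighbour {u} {y = y} {b = b} e e′ (_ , p@(step _ _ q) , s , u∉p) =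
      -- The three nodes required of a cycle are `u`, `x` and at least one node of `q`.
      ⊥-elim (acyclic (step u e p)
        (u∉p ∷ s , s≤s (s≤s (nonEmpty q)) , b , trans (label-sym y u) e′))
      where
      nonEmpty : ∀ {u v w} (p : Walk G u v w) → 1 ≤ length (nodes G p)
      nonEmpty (stop _)     = s≤s z≤n
      nonEmpty (step _ _ _) = s≤s z≤n

    simpleWord-unique : ∀ {u v w w′} (p : Walk G u v w) (q : Walk G u v w′) →
                        Simple G p → Simple G q → w ≡ w′
    simpleWord-unique (stop _)     (stop _)     _         _         = refl
    simpleWord-unique (stop _)     (step _ _ q) _         (u∉q ∷ _) =
      ⊥-elim (All.lookup u∉q (end∈nodes q) refl)
    simpleWord-unique (step _ _ p) (stop _)     (u∉p ∷ _) _         =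
      ⊥-elim (All.lookup u∉p (end∈nodes p) refl)
    simpleWord-unique (step u e p) (step _ e′ q) (u∉p ∷ s) (u∉q ∷ s′)
      -- Both tails avoid `u` by simplicity and end at the same node. Joined there, they connect the
      -- two neighbours of `u` without visiting `u`, so the first edges coincide.
      with refl ← uniqueNeighbour e e′
                    (loopErase (walkIn-euclidean (walkIn-sym (_ , p , u∉p))
                                                 (walkIn-sym (_ , q , u∉q)))) =
      cong₂ _∷_ (just-injective (trans (sym e) e′)) (simpleWord-unique p q s s′)

module _ {n σ : ℕ} (T : Tree n σ) where
  open Tree T

  simpleWalk : ∀ u v → SimpleWalkIn graph (λ _ → ⊤) u v
  simpleWalk u v with w , p ← connected u v =
    loopErase graph (w , p , All.universal (λ _ → tt) _)

  pathWord : Fin n → Fin n → Word σ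
  pathWord u v = proj₁ (simpleWalk u v)

  pathWords : List (Word σ)
  pathWords = cartesianProductWith pathWord (allFin n) (allFin n)

  -- One path is chosen per pair of nodes, and any other simple path between them spells the same
  -- word.
  L⇒∈pathWords : ∀ {w} → L T w → w ∈ pathWords
  L⇒∈pathWords (u , v , p , s) with simpleWalk u v in eq
  ... | _ , q , s′ , _ =
    subst (_∈ pathWords)
      (trans (cong proj₁ eq) (simpleWord-unique graph acyclic q p s′ s))
      (∈-cartesianProductWith⁺ pathWord (∈-allFin u) (∈-allFin v))

  ∈pathWords⇒L : ∀ {w} → w ∈ pathWords → L T w
  ∈pathWords⇒L w∈
    with u , v , _ , _ , refl ← ∈-cartesianProductWith⁻ pathWord (allFin n) (allFin n) w∈
    with _ , p , s , _ ← simpleWalk u v =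
    u , v , p , s

  L? : Decidable (L T)
  L? w = map′ ∈pathWords⇒L L⇒∈pathWords (any? (≡-dec _≟_ w) pathWords)

  -- A word has at most one factorization `a`, `u`, `b`, so testing the one found by `initLast`
  -- decides the existential.
  MAW? : Decidable (MAW T)
  MAW? []       = no λ ()
  MAW? (a ∷ v) with initLast v
  -- A one-letter word has no such factorization; splitting on the middle word exposes that `u ∷ʳ b`
  -- is nonempty.
  ... | []      = no λ { (_ , [] , _ , () , _) ; (_ , _ ∷ _ , _ , () , _) }
  ... | u ∷ʳ′ b = map′ to from (¬? (L? (a ∷ (u ∷ʳ b))) ×-dec L? (a ∷ u) ×-dec L? (u ∷ʳ b))
    where
    Minimal : Fin σ → Word σ → Fin σ → Set
    Minimal a u b = ¬ L T (a ∷ (u ∷ʳ b)) × L T (a ∷ u) × L T (u ∷ʳ b)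

    to : Minimal a u b → MAW T (a ∷ (u ∷ʳ b))
    to m = a , u , b , refl , m

    from : MAW T (a ∷ (u ∷ʳ b)) → Minimal a u b
    from (_ , u′ , _ , eq , m)
      with refl , eq′ ← ∷-injective eq
      with refl , refl ← ∷ʳ-injective u u′ eq′ = m

  extensions : List (Word σ)
  extensions = cartesianProductWith _∷ʳ_ pathWords (allFin σ)

  MAW⇒∈extensions : ∀ {w} → MAW T w → w ∈ extensions
  MAW⇒∈extensions (_ , _ , b , refl , _ , au∈L , _) =
    -- `a ∷ (u ∷ʳ b)` computes to `(a ∷ u) ∷ʳ b`, an extension of a word of the language.
    ∈-cartesianProductWith⁺ _∷ʳ_ (L⇒∈pathWords au∈L) (∈-allFin b)

  length-extensions : length extensions ≡ n ^ 2 * σ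
  length-extensions = begin
    length extensions                                    ≡⟨ length-cartesianProductWith _∷ʳ_ pathWords (allFin σ) ⟩
    length pathWords * length (allFin σ)                 ≡⟨ cong₂ _*_ (length-cartesianProductWith pathWord (allFin n) (allFin n)) (length-tabulate {n = σ} id) ⟩
    length (allFin n) * length (allFin n) * σ            ≡⟨ cong (λ m → m * m * σ) (length-tabulate {n = n} id) ⟩
    n * n * σ                                            ≡⟨ cong (λ m → n * m * σ) (*-identityʳ n) ⟨
    n ^ 2 * σ                                            ∎
    where open ≡-Reasoning

theorem3 : ∃[ C ] (0 < C ×
    (∀ (n σ : ℕ) → 1 ≤ n → 1 ≤ σ → (T : Tree n σ) →
    ∃[ k ] (HasCardinality (MAW T) k × k ≤ C * (n ^ 2 * σ))))
-- The candidates number exactly `n ^ 2 * σ`, so the constant is 1; `1 * m` unfolds to `m + 0`,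
-- which `+-identityʳ` removes.
theorem3 = 1 , s≤s z≤n , λ n σ _ _ T →
  let k , card , k≤ = enumerated⇒finite (≡-dec _≟_) (MAW? T) (extensions T) (MAW⇒∈extensions T)
  in  k , card , ≤-trans k≤ (≤-reflexive (trans (length-extensions T) (sym (+-identityʳ _))))
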